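{- There exists a deterministic algorithm in the value oracle model which, for any $k\ge 2$ and any $k$-XOS function $f\colon 2^V\to\mathbb{R}$ on a finite nonempty set $V$ of size $n$ given by a value oracle, finds a $(k-1)$-maximizer of $f$ in $O(k^2 n)$ time, even if $k$ is unknown to the algorithm. In particular, when $k=2$, it finds an exact maximizer of $f$ in $O(n)$ time.
   Context: A set function $f\colon 2^V\to\mathbb{R}$ is additive if $f(X)=\sum_{v\in X}f(\{v\})$ for all $X\subseteq V$. It is $k$-XOS if there are additive functions $f_1,\dots,f_k\colon 2^V\to\mathbb{R}$ (values may be negative) such that $f(X)=\max_{i\in[k]}f_i(X)$ for all $X\subseteq V$. A value oracle answers a query $X\subseteq V$ with $f(X)$; the additive functions $f_i$ are not given. For $\alpha\ge1$, $\tilde X\subseteq V$ is an $\alpha$-maximizer if $f(\tilde X)\ge\frac1\alpha\max_{X\subseteq V}f(X)$. Running time is measured by the number of value oracle calls, which asymptotically dominates the remaining computation. -}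

module Defs where

open import Algebra.Bundles using (CommutativeRing; Semiring)
open import Algebra.Structures using (IsCommutativeRing)
import Algebra.Definitions.RawSemiring as RawSemiringDefs
open import Data.Bool.Base using (if_then_else_)
open import Data.Fin.Base using (Fin)
open import Data.Fin.Subset using (Subset; ⁅_⁆)
open import Data.Nat.Base using (ℕ; zero; suc)
open import Data.Product.Base using (∃; ∃-syntax; _×_)
open import Data.Vec.Base using (lookup)
open import Level using (Level; _⊔_)
open import Relation.Binary.Core using (Rel)
open import Relation.Binary.PropositionalEquality.Core using (_≡_; _≢_)
open import Relation.Binary.Structures using (IsDecTotalOrder)

-- The library has no real numbers, so the range of a set function is an
-- arbitrary ordered field; ℝ is the intended instance.  The order is
-- decidable because algorithms compare oracle values exactly.
record OrderedField (c ℓ : Level) : Set (Level.suc (c ⊔ ℓ)) where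
  infix  9 _⁻¹
  infix  8 -_
  infixl 7 _*_
  infixl 6 _+_
  infix  4 _≤_
  field
    Carrier           : Set c
    _≤_               : Rel Carrier ℓ
    _+_ _*_           : Carrier → Carrier → Carrier
    -_                : Carrier → Carrier
    0# 1#             : Carrier
    -- Total, but unconstrained at 0#.
    _⁻¹               : Carrier → Carrier
    isCommutativeRing : IsCommutativeRing _≡_ _+_ _*_ -_ 0# 1#
    0#≢1#             : 0# ≢ 1#
    *-inverseʳ        : ∀ x → x ≢ 0# → x * x ⁻¹ ≡ 1#
    isDecTotalOrder   : IsDecTotalOrder _≡_ _≤_
    +-monoˡ-≤         : ∀ z {x y} → x ≤ y → x + z ≤ y + z
    *-nonNegative     : ∀ {x y} → 0# ≤ x → 0# ≤ y → 0# ≤ x * y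

  commutativeRing : CommutativeRing c c
  commutativeRing = record { isCommutativeRing = isCommutativeRing }

  open RawSemiringDefs
    (Semiring.rawSemiring (CommutativeRing.semiring commutativeRing)) public
    using (sum) renaming (_×_ to _·_)

  fromℕ : ℕ → Carrier
  fromℕ m = m · 1#

module SetFunctions {c ℓ} (R : OrderedField c ℓ) where
  open OrderedField R

  -- A ground set V of size n is taken to be Fin n.
  SetFunction : ℕ → Set c
  SetFunction n = Subset n → Carrier

  IsMaximum : {I : Set} → (I → Carrier) → Carrier → Set (c ⊔ ℓ)
  IsMaximum g m = (∃[ i ] g i ≡ m) × (∀ i → g i ≤ m)

  Additive : ∀ {n} → SetFunction n → Set c
  Additive f =
    ∀ X → f X ≡ sum (λ v → if lookup X v then f ⁅ v ⁆ else 0#)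

  XOS : ℕ → ∀ {n} → SetFunction n → Set (c ⊔ ℓ)
  XOS k {n} f = ∃ λ (fs : Fin k → SetFunction n) →
    (∀ i → Additive (fs i)) × (∀ X → IsMaximum (λ i → fs i X) (f X))

  IsMaximizer : Carrier → ∀ {n} → SetFunction n → Subset n → Set (c ⊔ ℓ)
  IsMaximizer α f X = ∃[ m ] IsMaximum f m × α ⁻¹ * m ≤ f X

  IsExactMaximizer : ∀ {n} → SetFunction n → Subset n → Set (c ⊔ ℓ)
  IsExactMaximizer f X = IsMaximum f (f X)

  -- A deterministic algorithm with value-oracle access, as a decision tree:
  -- each step depends only on the answers received so far.  The type being
  -- inductive, every run makes finitely many oracle calls.
  data Algorithm (n : ℕ) : Set c where
    return : Subset n → Algorithm n
    query  : Subset n → (Carrier → Algorithm n) → Algorithm n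

  output : ∀ {n} → Algorithm n → SetFunction n → Subset n
  output (return X)  f = X
  output (query X A) f = output (A (f X)) f

  oracleCalls : ∀ {n} → Algorithm n → SetFunction n → ℕ
  oracleCalls (return X)  f = zero
  oracleCalls (query X A) f = suc (oracleCalls (A (f X)) f)

{-# OPTIONS --safe #-}
module Submission where

-- Let w v = f {v} and call X tight for i if fᵢ {v} = w v for all v ∈ X.  Putting
-- each v with w v > 0 into the first group that stays tight for some i (that is,
-- with f (X ∪ {v}) = Σ w) yields m ≤ k groups with distinct labels i, so the best
-- group is an m-maximizer and only m = k needs care.  Suppose that fⱼ attains the
-- maximum and X is the group labelled j.  Starting at Y = X, add any v
-- that increases f.  As long as f Y = fⱼ Y this gains at least fⱼ⁺ {v} for each v,
-- and if it never stops, f Y = max f.  Otherwise f Y = fᵢ Y with i ≠ j for the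
-- first time after some set S has been seen; the group Z labelled i extends Y
-- additively, so f (Y ∪ Z) bounds fⱼ⁺ on S ∪ Z ⊇ X ∪ Z, and the k - 2 other groups
-- bound the rest.  All unions Y ∪ Z are tried.

open import Defs
open import Algebra.Bundles using (CommutativeRing)
import Algebra.Construct.NaturalChoice.Max as Max
import Algebra.Properties.CommutativeMonoid.Sum as Sum
import Algebra.Properties.Ring as RingProperties
import Algebra.Properties.Semiring.Mult as Mult
open import Data.Bool.Base using (true; false; if_then_else_)
open import Data.Fin.Base using (Fin; zero; suc)
open import Data.Fin.Properties using (injective⇒≤) renaming (_≟_ to _≟ᶠ_)
open import Data.Fin.Subset using (Subset; ⁅_⁆; ⊥; _∈_; _∉_; _⊆_; _∪_; _─_)
open import Data.Fin.Subset.Properties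
  using (_∈?_; x∈⁅x⁆; x∈⁅y⁆⇒x≡y; x∈p∪q⁺; x∈p∪q⁻; p⊆p∪q; q⊆p∪q; ∪-idem;
         x∈p∧x∉q⇒x∈p─q; p─q⊆p)
open import Data.List.Base
  using (List; []; _∷_; [_]; _++_; length; map; allFin; cartesianProductWith)
import Data.List.Base as List
import Data.List.Membership.Propositional as List using (_∈_)
open import Data.List.Membership.Propositional using (find; lose)
import Data.List.Membership.DecPropositional as DecMembership
open import Data.List.Membership.Propositional.Properties
  using (∈-∃++; ∈-lookup; ∈-allFin; ∈-map⁺; ∈-map⁻; ∈-cartesianProductWith⁺; ∈-++⁺ˡ; ∈-++⁺ʳ)
open import Data.List.Properties using (length-map; length-++; length-tabulate)
open import Data.List.Relation.Binary.Permutation.Propositional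
  using (_↭_; ↭-trans; prep)
open import Data.List.Relation.Binary.Permutation.Propositional.Properties
  using (shift; ↭-length; Any-resp-↭; All-resp-↭; ∈-resp-↭)
open import Data.List.Relation.Unary.All as All using (All; []; _∷_)
open import Data.List.Relation.Unary.AllPairs using (AllPairs; []; _∷_)
import Data.List.Relation.Unary.All.Properties as AllP
open import Data.List.Relation.Unary.Any using (Any; here; there)
import Data.List.Relation.Unary.Any.Properties as AnyP
open import Data.List.Relation.Unary.Unique.Propositional using (Unique)
open import Data.Nat.Base as ℕ using (ℕ; zero; suc; _*_; _^_; _∸_; _≤_)
import Data.Nat.Properties as ℕ
open import Data.Nat.Tactic.RingSolver using (solve-∀)
open import Data.Product.Base using (∃; ∃₂; ∃-syntax; _×_; _,_; proj₁; proj₂)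
open import Data.Sum.Base as ⊎ using (_⊎_; inj₁; inj₂; [_,_]′)
import Data.Vec.Functional as Vector
open import Data.Vec.Base using (lookup; []; _∷_; there)
open import Data.Vec.Properties using ([]=⇒lookup; lookup⇒[]=)
open import Function.Base using (_∘_; id)
open import Level using (Level; _⊔_)
import Relation.Binary.Reasoning.PartialOrder as PosetReasoning
open import Relation.Binary.Bundles using (TotalOrder)
open import Relation.Binary.PropositionalEquality
  using (_≡_; _≢_; refl; sym; trans; cong; cong₂; subst; module ≡-Reasoning)
open import Relation.Binary.Structures using (IsDecTotalOrder)
open import Relation.Nullary.Decidable using (Dec; yes; no; does)
open import Relation.Nullary.Negation using (¬_; contradiction)

private variable
  a b p q : Level
  A : Set a
  B : Set b
  n : ℕ

-- Set differences, repetition-free lists and permutations.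

x∈p─q⇒x∉q : ∀ (p q : Subset n) {x} → x ∈ p ─ q → x ∉ q
x∈p─q⇒x∉q (_ ∷ p) (true ∷ q) (there x∈p─q) (there x∈q) = x∈p─q⇒x∉q p q x∈p─q x∈q
x∈p─q⇒x∉q (_ ∷ p) (false ∷ q) (there x∈p─q) (there x∈q) = x∈p─q⇒x∉q p q x∈p─q x∈q

module _ {A : Set a} where

  map-proj₁-toList : {P : A → Set p} {xs : List A} (pxs : All P xs) →
                     map proj₁ (All.toList pxs) ≡ xs
  map-proj₁-toList []         = refl
  map-proj₁-toList (px ∷ pxs) = cong (_ ∷_) (map-proj₁-toList pxs)

  lookup-injective : {xs : List A} → Unique xs →
                     ∀ {i j} → List.lookup xs i ≡ List.lookup xs j → i ≡ j
  lookup-injective (x∉xs ∷ xs!) {zero}  {zero}  eq = refl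
  lookup-injective (x∉xs ∷ xs!) {zero}  {suc j} eq =
    contradiction eq (All.lookup x∉xs (∈-lookup j))
  lookup-injective (x∉xs ∷ xs!) {suc i} {zero}  eq =
    contradiction (sym eq) (All.lookup x∉xs (∈-lookup i))
  lookup-injective (x∉xs ∷ xs!) {suc i} {suc j} eq = cong suc (lookup-injective xs! eq)

  ∈⇒↭∷ : {x : A} {xs : List A} → x List.∈ xs → ∃ λ ys → xs ↭ x ∷ ys
  ∈⇒↭∷ x∈xs with ys , zs , refl ← ∈-∃++ x∈xs = ys ++ zs , shift _ ys zs

  length-cartesianProductWith : {B : Set b} {C : Set q} (f : A → B → C) →
                                ∀ xs ys → length (cartesianProductWith f xs ys) ≡
                                          length xs * length ys
  length-cartesianProductWith f []       ys = refl
  length-cartesianProductWith f (x ∷ xs) ys = trans (length-++ (map (f x) ys))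
    (cong₂ ℕ._+_ (length-map (f x) ys) (length-cartesianProductWith f xs ys))

-- Pigeonhole: list positions inject into `Fin n`. Every bound on the number of groups by `k` comes
-- from here, applied to lists of labels.
Unique⇒length≤ : {is : List (Fin n)} → Unique is → length is ≤ n
Unique⇒length≤ is! = injective⇒≤ (lookup-injective is!)

-- Arithmetic in an ordered field.

module OrderedFieldProperties {c ℓ} (R : OrderedField c ℓ) where
  open OrderedField R renaming (_≤_ to _≤ᴿ_; _*_ to _*ᴿ_)
  open IsDecTotalOrder isDecTotalOrder public
    using (_≟_; _≤?_; isTotalOrder)
    renaming (refl to ≤-refl; reflexive to ≤-reflexive; trans to ≤-trans;
              antisym to ≤-antisym; total to ≤-total)
  open CommutativeRing commutativeRing public
    using (+-comm; +-assoc; +-identityˡ; +-identityʳ; *-comm; *-assoc;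
           *-identityˡ; *-identityʳ; -‿inverseˡ; -‿inverseʳ; ring; semiring;
           +-commutativeMonoid)

  totalOrder : TotalOrder _ _ _
  totalOrder = record { isTotalOrder = isTotalOrder }

  open Max totalOrder public renaming (_⊔_ to _⊔ᴿ_)
  module ≤-Reasoning = PosetReasoning (TotalOrder.poset totalOrder)
  open Mult semiring using (×-assoc-*)
  open Sum +-commutativeMonoid using (∑-distrib-+; sum-cong-≗)
  open RingProperties ring using (-‿distribʳ-*; -‿involutive)

  +-mono-≤ : ∀ {w x y z} → w ≤ᴿ x → y ≤ᴿ z → w + y ≤ᴿ x + z
  +-mono-≤ {w} {x} {y} {z} w≤x y≤z = begin
    w + y  ≤⟨ +-monoˡ-≤ y w≤x ⟩
    x + y  ≡⟨ +-comm x y ⟩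
    y + x  ≤⟨ +-monoˡ-≤ x y≤z ⟩
    z + x  ≡⟨ +-comm z x ⟩
    x + z  ∎
    where open ≤-Reasoning

  +-cancelʳ-≤ : ∀ {x y} z → x + z ≤ᴿ y + z → x ≤ᴿ y
  +-cancelʳ-≤ {x} {y} z x+z≤y+z = begin
    x                ≡⟨ x+z-z≡x x ⟨
    x + z + - z      ≤⟨ +-monoˡ-≤ (- z) x+z≤y+z ⟩
    y + z + - z      ≡⟨ x+z-z≡x y ⟩
    y                ∎
    where
    open ≤-Reasoning
    x+z-z≡x : ∀ x → x + z + - z ≡ x
    x+z-z≡x x = trans (+-assoc x z (- z)) (trans (cong (x +_) (-‿inverseʳ z)) (+-identityʳ x))

  +-cancelˡ-≤ : ∀ x {y z} → x + y ≤ᴿ x + z → y ≤ᴿ z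
  +-cancelˡ-≤ x {y} {z} x+y≤x+z = +-cancelʳ-≤ x (begin
    y + x  ≡⟨ +-comm y x ⟩
    x + y  ≤⟨ x+y≤x+z ⟩
    x + z  ≡⟨ +-comm x z ⟩
    z + x  ∎)
    where open ≤-Reasoning

  x≤0⇒0≤-x : ∀ {x} → x ≤ᴿ 0# → 0# ≤ᴿ - x
  x≤0⇒0≤-x {x} x≤0 = begin
    0#         ≡⟨ -‿inverseʳ x ⟨
    x + - x    ≤⟨ +-monoˡ-≤ (- x) x≤0 ⟩
    0# + - x   ≡⟨ +-identityˡ (- x) ⟩
    - x        ∎
    where open ≤-Reasoning

  0≤-x⇒x≤0 : ∀ {x} → 0# ≤ᴿ - x → x ≤ᴿ 0#
  0≤-x⇒x≤0 {x} 0≤-x = subst (_≤ᴿ 0#) (-‿involutive x)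
    (+-cancelʳ-≤ (- x) (begin
      - - x + - x  ≡⟨ -‿inverseˡ (- x) ⟩
      0#           ≤⟨ 0≤-x ⟩
      - x          ≡⟨ +-identityˡ (- x) ⟨
      0# + - x     ∎))
    where open ≤-Reasoning

  0≤1 : 0# ≤ᴿ 1#
  0≤1 with ≤-total 0# 1#
  ... | inj₁ 0≤1 = 0≤1
  ... | inj₂ 1≤0 = begin
    0#               ≤⟨ *-nonNegative (x≤0⇒0≤-x 1≤0) (x≤0⇒0≤-x 1≤0) ⟩
    - 1# *ᴿ - 1#     ≡⟨ -‿distribʳ-* (- 1#) 1# ⟨
    - (- 1# *ᴿ 1#)   ≡⟨ cong -_ (*-identityʳ (- 1#)) ⟩
    - - 1#           ≡⟨ -‿involutive 1# ⟩
    1#               ∎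
    where open ≤-Reasoning

  ⁻¹-nonNegative : ∀ {x} → 0# ≤ᴿ x → x ≢ 0# → 0# ≤ᴿ x ⁻¹
  ⁻¹-nonNegative {x} 0≤x x≢0 with ≤-total 0# (x ⁻¹)
  ... | inj₁ 0≤x⁻¹ = 0≤x⁻¹
  ... | inj₂ x⁻¹≤0 = contradiction (≤-antisym 0≤1 (0≤-x⇒x≤0 (begin
    0#              ≤⟨ *-nonNegative 0≤x (x≤0⇒0≤-x x⁻¹≤0) ⟩
    x *ᴿ - (x ⁻¹)   ≡⟨ -‿distribʳ-* x (x ⁻¹) ⟨
    - (x *ᴿ x ⁻¹)   ≡⟨ cong -_ (*-inverseʳ x x≢0) ⟩
    - 1#            ∎))) 0#≢1#
    where open ≤-Reasoning

  +-nonNegative : ∀ {x y} → 0# ≤ᴿ x → 0# ≤ᴿ y → 0# ≤ᴿ x + y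
  +-nonNegative {x} {y} 0≤x 0≤y =
    subst (_≤ᴿ x + y) (+-identityˡ 0#) (+-mono-≤ 0≤x 0≤y)

  ·-nonNegative : ∀ m {x} → 0# ≤ᴿ x → 0# ≤ᴿ m · x
  ·-nonNegative zero    0≤x = ≤-refl
  ·-nonNegative (suc m) 0≤x = +-nonNegative 0≤x (·-nonNegative m 0≤x)

  ·-monoˡ-≤ : ∀ {l m x} → 0# ≤ᴿ x → l ≤ m → l · x ≤ᴿ m · x
  ·-monoˡ-≤ {m = m} 0≤x ℕ.z≤n = ·-nonNegative m 0≤x
  ·-monoˡ-≤ 0≤x (ℕ.s≤s l≤m) = +-mono-≤ ≤-refl (·-monoˡ-≤ 0≤x l≤m)

  fromℕ-suc≢0 : ∀ m → fromℕ (suc m) ≢ 0#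
  fromℕ-suc≢0 m 1+m≡0 = 0#≢1# (≤-antisym 0≤1 (begin
    1#             ≡⟨ +-identityʳ 1# ⟨
    1# + 0#        ≤⟨ +-mono-≤ ≤-refl (·-nonNegative m 0≤1) ⟩
    fromℕ (suc m)  ≡⟨ 1+m≡0 ⟩
    0#             ∎))
    where open ≤-Reasoning

  -- The analysis bounds the maximum by an integer multiple of the value found; this passes to the
  -- division form of `IsMaximizer`. The nonnegative difference `suc m · y + - x` is multiplied by
  -- the nonnegative `α ⁻¹`.
  ≤·⇒⁻¹*≤ : ∀ m {x y} → x ≤ᴿ suc m · y → fromℕ (suc m) ⁻¹ *ᴿ x ≤ᴿ y
  ≤·⇒⁻¹*≤ m {x} {y} x≤my = begin
    α ⁻¹ *ᴿ x              ≡⟨ +-identityʳ _ ⟨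
    α ⁻¹ *ᴿ x + 0#         ≤⟨ +-mono-≤ ≤-refl (*-nonNegative 0≤α⁻¹ 0≤my-x) ⟩
    α ⁻¹ *ᴿ x + α ⁻¹ *ᴿ (suc m · y + - x)
                           ≡⟨ CommutativeRing.distribˡ commutativeRing (α ⁻¹) x _ ⟨
    α ⁻¹ *ᴿ (x + (suc m · y + - x))
                           ≡⟨ cong (α ⁻¹ *ᴿ_) x+[my-x]≡my ⟩
    α ⁻¹ *ᴿ (suc m · y)    ≡⟨ cong (λ z → α ⁻¹ *ᴿ (suc m · z)) (*-identityˡ y) ⟨
    α ⁻¹ *ᴿ (suc m · (1# *ᴿ y))
                           ≡⟨ cong (α ⁻¹ *ᴿ_) (×-assoc-* (suc m) 1# y) ⟨
    α ⁻¹ *ᴿ (α *ᴿ y)       ≡⟨ *-assoc (α ⁻¹) α y ⟨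
    α ⁻¹ *ᴿ α *ᴿ y         ≡⟨ cong (_*ᴿ y) (trans (*-comm (α ⁻¹) α) (*-inverseʳ α α≢0)) ⟩
    1# *ᴿ y                ≡⟨ *-identityˡ y ⟩
    y                      ∎
    where
    open ≤-Reasoning
    α = fromℕ (suc m)
    α≢0 = fromℕ-suc≢0 m
    0≤α⁻¹ = ⁻¹-nonNegative (·-nonNegative (suc m) 0≤1) α≢0
    0≤my-x : 0# ≤ᴿ suc m · y + - x
    0≤my-x = subst (_≤ᴿ suc m · y + - x) (-‿inverseʳ x) (+-monoˡ-≤ (- x) x≤my)
    x+[my-x]≡my : x + (suc m · y + - x) ≡ suc m · y
    x+[my-x]≡my = begin-equality
      x + (suc m · y + - x)  ≡⟨ +-comm x _ ⟩
      suc m · y + - x + x    ≡⟨ +-assoc _ (- x) x ⟩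
      suc m · y + (- x + x)  ≡⟨ cong (suc m · y +_) (-‿inverseˡ x) ⟩
      suc m · y + 0#         ≡⟨ +-identityʳ _ ⟩
      suc m · y              ∎

  -- For `k = 2` the ratio is `fromℕ 1`, which unfolds to `1# + 0#` rather than `1#`; with its
  -- inverse simplified, the maximizer is seen to be exact.
  fromℕ-1⁻¹* : ∀ x → fromℕ 1 ⁻¹ *ᴿ x ≡ x
  fromℕ-1⁻¹* x = trans (cong (_*ᴿ x) (begin
    α ⁻¹        ≡⟨ *-identityˡ (α ⁻¹) ⟨
    1# *ᴿ α ⁻¹  ≡⟨ cong (_*ᴿ α ⁻¹) (+-identityʳ 1#) ⟨
    α *ᴿ α ⁻¹   ≡⟨ *-inverseʳ α (fromℕ-suc≢0 0) ⟩
    1#          ∎)) (*-identityˡ x)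
    where
    open ≡-Reasoning
    α = fromℕ 1

  -- Sums over the ground set and its subsets.

  sum-mono-≤ : {g h : Fin n → Carrier} → (∀ v → g v ≤ᴿ h v) → sum g ≤ᴿ sum h
  sum-mono-≤ {n = zero}  g≤h = ≤-refl
  sum-mono-≤ {n = suc _} g≤h = +-mono-≤ (g≤h zero) (sum-mono-≤ (g≤h ∘ suc))

  -- Termwise inequalities leave no slack once the sums agree. This lets a single oracle value
  -- certify tightness of all elements of a set at once.
  sum-≤-rigid : {g h : Fin n → Carrier} → (∀ v → g v ≤ᴿ h v) →
                sum h ≤ᴿ sum g → ∀ v → g v ≡ h v
  sum-≤-rigid {g = g} {h} g≤h ∑h≤∑g zero = ≤-antisym (g≤h zero)
    (+-cancelʳ-≤ (sum (h ∘ suc)) (≤-trans ∑h≤∑g (+-mono-≤ ≤-refl (sum-mono-≤ (g≤h ∘ suc)))))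
  sum-≤-rigid {g = g} {h} g≤h ∑h≤∑g (suc v) = sum-≤-rigid (g≤h ∘ suc)
    (+-cancelˡ-≤ (h zero) (≤-trans ∑h≤∑g (+-monoˡ-≤ _ (g≤h zero)))) v

  restrict : Subset n → (Fin n → Carrier) → Fin n → Carrier
  restrict X g v = if lookup X v then g v else 0#

  -- The additive set function with singleton values `g`, in the same form as in `Additive`, so that
  -- additivity of `fs i` reads `fs i X ≡ ⟦ coeff i ⟧ X`.
  ⟦_⟧ : (Fin n → Carrier) → Subset n → Carrier
  ⟦ g ⟧ X = sum (restrict X g)

  module _ {X : Subset n} (g : Fin n → Carrier) {v : Fin n} where

    restrict-∈ : v ∈ X → restrict X g v ≡ g v
    restrict-∈ v∈X = cong (if_then g v else 0#) ([]=⇒lookup v∈X)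

    restrict-∉ : v ∉ X → restrict X g v ≡ 0#
    restrict-∉ v∉X with lookup X v in eq
    ... | true  = contradiction (lookup⇒[]= v X eq) v∉X
    ... | false = refl

  restrict-nonNegative : (X : Subset n) {g : Fin n → Carrier} →
                         (∀ v → 0# ≤ᴿ g v) → ∀ v → 0# ≤ᴿ restrict X g v
  restrict-nonNegative X 0≤g v with lookup X v
  ... | true  = 0≤g v
  ... | false = ≤-refl

  ⟦⟧-cong : {g h : Fin n → Carrier} (X : Subset n) →
            (∀ v → v ∈ X → g v ≡ h v) → ⟦ g ⟧ X ≡ ⟦ h ⟧ X
  ⟦⟧-cong {g = g} {h} X g≗h = sum-cong-≗ restrict-cong
    where
    restrict-cong : ∀ v → restrict X g v ≡ restrict X h v
    restrict-cong v with v ∈? X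
    ... | yes v∈X = trans (restrict-∈ g v∈X) (trans (g≗h v v∈X) (sym (restrict-∈ h v∈X)))
    ... | no  v∉X = trans (restrict-∉ g v∉X) (sym (restrict-∉ h v∉X))

  restrict-mono-≤ : {g h : Fin n → Carrier} (X : Subset n) →
                    (∀ v → g v ≤ᴿ h v) → ∀ v → restrict X g v ≤ᴿ restrict X h v
  restrict-mono-≤ X g≤h v with lookup X v
  ... | true  = g≤h v
  ... | false = ≤-refl

  ⟦⟧≤sum : {g : Fin n → Carrier} (X : Subset n) →
           (∀ v → 0# ≤ᴿ g v) → ⟦ g ⟧ X ≤ᴿ sum g
  ⟦⟧≤sum {g = g} X 0≤g = sum-mono-≤ restrict-≤
    where
    restrict-≤ : ∀ v → restrict X g v ≤ᴿ g v
    restrict-≤ v with lookup X v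
    ... | true  = ≤-refl
    ... | false = 0≤g v

  ⟦⟧-⊥ : (g : Fin n → Carrier) → ⟦ g ⟧ ⊥ ≡ 0#
  ⟦⟧-⊥ {n = zero}  g = refl
  ⟦⟧-⊥ {n = suc _} g = trans (+-identityˡ _) (⟦⟧-⊥ (g ∘ suc))

  ⟦⟧-⁅⁆ : (g : Fin n → Carrier) (v : Fin n) → ⟦ g ⟧ ⁅ v ⁆ ≡ g v
  ⟦⟧-⁅⁆ g zero    = trans (cong (g zero +_) (⟦⟧-⊥ (g ∘ suc))) (+-identityʳ _)
  ⟦⟧-⁅⁆ g (suc v) = trans (+-identityˡ _) (⟦⟧-⁅⁆ (g ∘ suc) v)

  ⟦⟧-∪-disjoint : (g : Fin n → Carrier) {X Y : Subset n} →
                  (∀ {v} → v ∈ X → v ∉ Y) → ⟦ g ⟧ (X ∪ Y) ≡ ⟦ g ⟧ X + ⟦ g ⟧ Y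
  ⟦⟧-∪-disjoint g {X} {Y} disjoint =
    trans (sum-cong-≗ pointwise) (∑-distrib-+ (restrict X g) (restrict Y g))
    where
    pointwise : ∀ v → restrict (X ∪ Y) g v ≡ restrict X g v + restrict Y g v
    pointwise v with v ∈? X | v ∈? Y
    ... | yes v∈X | yes v∈Y = contradiction v∈Y (disjoint v∈X)
    ... | yes v∈X | no  v∉Y
      rewrite restrict-∈ g v∈X | restrict-∉ g v∉Y | restrict-∈ {X = X ∪ Y} g (x∈p∪q⁺ (inj₁ v∈X))
      = sym (+-identityʳ _)
    ... | no  v∉X | yes v∈Y
      rewrite restrict-∉ g v∉X | restrict-∈ g v∈Y | restrict-∈ {X = X ∪ Y} g (x∈p∪q⁺ (inj₂ v∈Y))
      = sym (+-identityˡ _)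
    ... | no  v∉X | no  v∉Y
      rewrite restrict-∉ g v∉X | restrict-∉ g v∉Y
            | restrict-∉ {X = X ∪ Y} g ([ v∉X , v∉Y ]′ ∘ x∈p∪q⁻ X Y)
      = sym (+-identityʳ _)

  ⟦⟧-∪-⁅⁆ : (g : Fin n → Carrier) {X : Subset n} {v : Fin n} →
            v ∉ X → ⟦ g ⟧ (X ∪ ⁅ v ⁆) ≡ ⟦ g ⟧ X + g v
  ⟦⟧-∪-⁅⁆ g {X} {v} v∉X = trans
    (⟦⟧-∪-disjoint g (λ {u} u∈X u∈⁅v⁆ → v∉X (subst (_∈ X) (x∈⁅y⁆⇒x≡y v u∈⁅v⁆) u∈X)))
    (cong (⟦ g ⟧ X +_) (⟦⟧-⁅⁆ g v))

  -- Each `v` is paid for by `h` or by a set of the list, where `u` dominates `g`. The induction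
  -- moves the first set into `h` by adding `restrict X u`, at a cost of at most `x`; overlaps do no
  -- harm, as `u` and `h` are nonnegative.
  cover-bound : {g u h : Fin n → Carrier} {x : Carrier} (Xs : List (Subset n)) →
                (∀ v → 0# ≤ᴿ u v) → (∀ v → g v ≤ᴿ u v) → (∀ v → 0# ≤ᴿ h v) →
                (∀ v → g v ≤ᴿ h v ⊎ Any (v ∈_) Xs) →
                All (λ X → ⟦ u ⟧ X ≤ᴿ x) Xs →
                sum g ≤ᴿ sum h + length Xs · x
  cover-bound {h = h} [] 0≤u g≤u 0≤h cover [] =
    subst (_ ≤ᴿ_) (sym (+-identityʳ _)) (sum-mono-≤ (λ v → [ id , (λ ()) ]′ (cover v)))
  cover-bound {g = g} {u} {h} {x} (X ∷ Xs) 0≤u g≤u 0≤h cover (uX≤x ∷ uXs≤x) = begin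
    sum g                               ≤⟨ cover-bound Xs 0≤u g≤u 0≤h′ cover′ uXs≤x ⟩
    sum h′ + length Xs · x              ≡⟨ cong (_+ length Xs · x) (∑-distrib-+ h (restrict X u)) ⟩
    sum h + ⟦ u ⟧ X + length Xs · x     ≤⟨ +-monoˡ-≤ _ (+-mono-≤ ≤-refl uX≤x) ⟩
    sum h + x + length Xs · x           ≡⟨ +-assoc (sum h) x _ ⟩
    sum h + (x + length Xs · x)         ∎
    where
    open ≤-Reasoning
    h′ : Fin _ → Carrier
    h′ v = h v + restrict X u v
    0≤h′ : ∀ v → 0# ≤ᴿ h′ v
    0≤h′ v = +-nonNegative (0≤h v) (restrict-nonNegative X 0≤u v)
    cover′ : ∀ v → g v ≤ᴿ h′ v ⊎ Any (v ∈_) Xs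
    cover′ v with cover v
    ... | inj₁ g≤h = inj₁ (subst (_≤ᴿ h′ v) (+-identityʳ _)
                       (+-mono-≤ g≤h (restrict-nonNegative X 0≤u v)))
    ... | inj₂ (here v∈X) = inj₁ (subst (_≤ᴿ h′ v) (+-identityˡ _)
            (+-mono-≤ (0≤h v) (subst (g v ≤ᴿ_) (sym (restrict-∈ u v∈X)) (g≤u v))))
    ... | inj₂ (there v∈Xs) = inj₂ v∈Xs

  -- Serves the analysis only, not the algorithm: `IsMaximizer` refers to an attained maximum, which
  -- exhaustive comparison supplies.
  maximum-exists : (f : Subset n → Carrier) → ∃[ X ] (∀ Y → f Y ≤ᴿ f X)
  maximum-exists {n = zero}  f = [] , λ { [] → ≤-refl }
  maximum-exists {n = suc _} f
    with X , X-max ← maximum-exists (f ∘ (true ∷_))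
       | Y , Y-max ← maximum-exists (f ∘ (false ∷_))
    with ≤-total (f (true ∷ X)) (f (false ∷ Y))
  ... | inj₁ X≤Y = false ∷ Y , λ { (true ∷ Z) → ≤-trans (X-max Z) X≤Y ; (false ∷ Z) → Y-max Z }
  ... | inj₂ Y≤X = true ∷ X , λ { (true ∷ Z) → X-max Z ; (false ∷ Z) → ≤-trans (Y-max Z) Y≤X }

-- Oracle computations and their specifications.

-- An oracle computation is represented by its effect on a continuation.
module OracleComputation {c ℓ} (R : OrderedField c ℓ) where
  open OrderedField R using (Carrier)
  open SetFunctions R

  Comp : ℕ → Set a → Set (a ⊔ c)
  Comp n A = (A → Algorithm n) → Algorithm n

  pure : A → Comp n A
  pure x K = K x

  infixl 1 _>>=_
  _>>=_ : Comp n A → (A → Comp n B) → Comp n B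
  (p >>= g) K = p λ x → g x K

  ask : Subset n → Comp n Carrier
  ask = query

  -- A Hoare-style specification for runs against the oracle `f`. In continuation-passing form a
  -- computation has no output of its own, so the last two fields compare `p K` with `K result` for
  -- every `K`; this is what makes specifications compose under `>>=`.
  record Ensures {A : Set a} (f : SetFunction n) (calls : ℕ) (p : Comp n A)
                 (Q : A → Set q) : Set (a ⊔ q ⊔ c) where
    constructor ensures
    field
      result        : A
      postcondition : Q result
      output-≡      : ∀ K → output (p K) f ≡ output (K result) f
      oracleCalls-≤ : ∀ K → oracleCalls (p K) f ≤ calls ℕ.+ oracleCalls (K result) f

  module _ {f : SetFunction n} where

    ensures-pure : {Q : A → Set q} {x : A} → Q x → Ensures f 0 (pure x) Q
    ensures-pure Qx = ensures _ Qx (λ _ → refl) (λ _ → ℕ.≤-refl)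

    ensures-ask : ∀ X → Ensures f 1 (ask X) (_≡ f X)
    ensures-ask X = ensures (f X) refl (λ _ → refl) (λ _ → ℕ.≤-refl)

    ensures-bind : ∀ {s t} {P : A → Set p} {Q : B → Set q} {r : Comp n A} {g : A → Comp n B} →
                   Ensures f s r P → (∀ x → P x → Ensures f t (g x) Q) →
                   Ensures f (s ℕ.+ t) (r >>= g) Q
    ensures-bind {s = s} {t} (ensures x Px out calls) next with next x Px
    ... | ensures y Qy out′ calls′ = ensures y Qy
      (λ K → trans (out _) (out′ K))
      (λ K → ℕ.≤-trans (calls _)
        (ℕ.≤-trans (ℕ.+-monoʳ-≤ s (calls′ K)) (ℕ.≤-reflexive (sym (ℕ.+-assoc s t _)))))

    ensures-if : ∀ {t} {P : Set p} {Q : A → Set q} {r s : Comp n A} (P? : Dec P) →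
                 (P → Ensures f t r Q) → (¬ P → Ensures f t s Q) →
                 Ensures f t (if does P? then r else s) Q
    ensures-if (yes p) thn els = thn p
    ensures-if (no ¬p) thn els = els ¬p

    ensures-weaken : ∀ {s t} {P : A → Set p} {Q : A → Set q} {r : Comp n A} →
                     s ≤ t → (∀ {x} → P x → Q x) → Ensures f s r P → Ensures f t r Q
    ensures-weaken s≤t P⇒Q (ensures x Px out calls) =
      ensures x (P⇒Q Px) out (λ K → ℕ.≤-trans (calls K) (ℕ.+-monoˡ-≤ _ s≤t))

-- The algorithm.

module XOSMaximization {c ℓ} (R : OrderedField c ℓ) where
  open OrderedField R renaming (_≤_ to _≤ᴿ_; _*_ to _*ᴿ_)
  open OrderedFieldProperties R
  open SetFunctions R
  open OracleComputation R

  askAll : ∀ {m} → (Fin m → Subset n) → Comp n (Fin m → Carrier)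
  askAll {m = zero}  Xs = pure λ ()
  askAll {m = suc _} Xs = do
    x ← ask (Xs zero)
    xs ← askAll (Xs ∘ suc)
    pure (x Vector.∷ xs)

  -- First fit: `v` joins the first group whose enlarged value equals the sum of the singleton
  -- values. These are tabulated in `w`, so each test costs one query, and opening a new group costs
  -- none.
  insert : (Fin n → Carrier) → Fin n → List (Subset n) → Comp n (List (Subset n))
  insert w v []       = pure [ ⁅ v ⁆ ]
  insert w v (X ∷ Xs) = do
    x ← ask (X ∪ ⁅ v ⁆)
    if does (x ≟ ⟦ w ⟧ (X ∪ ⁅ v ⁆))
      then pure (X ∪ ⁅ v ⁆ ∷ Xs)
      else (do
        Ys ← insert w v Xs
        pure (X ∷ Ys))

  group : (Fin n → Carrier) → List (Fin n) → List (Subset n) → Comp n (List (Subset n))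
  group w []       Xs = pure Xs
  group w (v ∷ vs) Xs = do
    Ys ← if does (w v ≤? 0#) then pure Xs else insert w v Xs
    group w vs Ys

  -- Every set on the way is kept, because the algorithm is not told at which moment the function
  -- attaining `f` changes.
  ascend : Subset n → List (Fin n) → Comp n (List (Subset n))
  ascend X []       = pure [ X ]
  ascend X (v ∷ vs) = do
    x ← ask X
    y ← ask (X ∪ ⁅ v ⁆)
    Ys ← ascend (if does (y ≤? x) then X else X ∪ ⁅ v ⁆) vs
    pure (X ∷ Ys)

  ascendAll : List (Subset n) → Comp n (List (Subset n))
  ascendAll []       = pure []
  ascendAll (X ∷ Xs) = do
    Ys ← ascend X (allFin _)
    Zs ← ascendAll Xs
    pure (Ys ++ Zs)

  best : Subset n → List (Subset n) → Comp n (Subset n)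
  best X []       = pure X
  best X (Y ∷ Ys) = do
    x ← ask X
    y ← ask Y
    best (if does (x ≤? y) then Y else X) Ys

  -- The number `k` does not occur; it enters the analysis as a bound on the number of groups.
  maximize : ∀ n → Algorithm n
  maximize n = (do
    w ← askAll ⁅_⁆
    Xs ← group w (allFin n) []
    Ys ← ascendAll Xs
    -- The default `⊥` has value at least 0, so the value found is nonnegative even if there are no
    -- groups and hence no other candidates.
    best ⊥ (cartesianProductWith _∪_ Ys Xs)) return

  -- Coefficients, tight sets and separated groups.

  module _ {n k : ℕ} (f : SetFunction n) (fs : Fin k → SetFunction n)
           (additive : ∀ i → Additive (fs i))
           (maximum : ∀ X → IsMaximum (λ i → fs i X) (f X)) where

    open DecMembership (_≟ᶠ_ {k}) using () renaming (_∈?_ to _∈?ᶠ_)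

    weight : Fin n → Carrier
    weight v = f ⁅ v ⁆

    coeff : Fin k → Fin n → Carrier
    coeff i v = fs i ⁅ v ⁆

    weight⁺ : Fin n → Carrier
    weight⁺ v = weight v ⊔ᴿ 0#

    -- `sum (coeff⁺ j)` is the largest value of `fs j`, so it suffices to bound this sum for every
    -- `j`.
    coeff⁺ : Fin k → Fin n → Carrier
    coeff⁺ i v = coeff i v ⊔ᴿ 0#

    coeff≤weight : ∀ i v → coeff i v ≤ᴿ weight v
    coeff≤weight i v = proj₂ (maximum ⁅ v ⁆) i

    coeff⁺≤weight⁺ : ∀ i v → coeff⁺ i v ≤ᴿ weight⁺ v
    coeff⁺≤weight⁺ i v = ⊔-monoˡ-≤ 0# (coeff≤weight i v)

    0≤coeff⁺ : ∀ i v → 0# ≤ᴿ coeff⁺ i v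
    0≤coeff⁺ i v = x≤y⊔x (coeff i v) 0#

    0≤weight⁺ : ∀ v → 0# ≤ᴿ weight⁺ v
    0≤weight⁺ v = x≤y⊔x (weight v) 0#

    coeff≤f : ∀ i X → ⟦ coeff i ⟧ X ≤ᴿ f X
    coeff≤f i X = subst (_≤ᴿ f X) (additive i X) (proj₂ (maximum X) i)

    Attains : Fin k → Subset n → Set c
    Attains i X = ⟦ coeff i ⟧ X ≡ f X

    attained : ∀ X → ∃[ i ] Attains i X
    attained X with i , fsX≡fX ← proj₁ (maximum X) = i , trans (sym (additive i X)) fsX≡fX

    TightOn : Fin k → Subset n → Set c
    TightOn i X = ∀ v → v ∈ X → coeff i v ≡ weight v

    tightOn-∪ : ∀ {i X Y} → TightOn i X → TightOn i Y → TightOn i (X ∪ Y)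
    tightOn-∪ {X = X} {Y} tightX tightY v v∈X∪Y = [ tightX v , tightY v ]′ (x∈p∪q⁻ X Y v∈X∪Y)

    -- The sum of the weights is an upper bound for `f X`, since every `coeff j` lies below
    -- `weight`; a function tight on `X` reaches it.
    tight⇒f≡weight : ∀ {i X} → TightOn i X → f X ≡ ⟦ weight ⟧ X
    tight⇒f≡weight {i} {X} tight with j , jX ← attained X = ≤-antisym
      (begin
        f X             ≡⟨ jX ⟨
        ⟦ coeff j ⟧ X   ≤⟨ sum-mono-≤ (restrict-mono-≤ X (coeff≤weight j)) ⟩
        ⟦ weight ⟧ X    ∎)
      (begin
        ⟦ weight ⟧ X    ≡⟨ ⟦⟧-cong X tight ⟨
        ⟦ coeff i ⟧ X   ≤⟨ coeff≤f i X ⟩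
        f X             ∎)
      where open ≤-Reasoning

    -- The converse, by rigidity applied to a function attaining `f X`. The two directions together
    -- justify the test in `insert`.
    f≡weight⇒tight : ∀ {X} → f X ≡ ⟦ weight ⟧ X → ∃[ i ] TightOn i X
    f≡weight⇒tight {X} fX≡ with i , iX ← attained X = i , tight
      where
      rigid : ∀ v → restrict X (coeff i) v ≡ restrict X weight v
      rigid = sum-≤-rigid (restrict-mono-≤ X (coeff≤weight i))
        (≤-reflexive (trans (sym fX≡) (sym iX)))
      tight : TightOn i X
      tight v v∈X = trans (sym (restrict-∈ (coeff i) v∈X)) (trans (rigid v) (restrict-∈ weight v∈X))

    -- Growing groups carry no fixed labels, as the function tight on a group may change when an
    -- element joins. Separation survives every enlargement and still forces distinct labels at the
    -- end.
    Separated : Subset n → Subset n → Set c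
    Separated X Y = ∀ {i} → TightOn i X → ¬ TightOn i Y

    separated-⊆ : ∀ {X X′ Y Y′} → X ⊆ X′ → Y ⊆ Y′ → Separated X Y → Separated X′ Y′
    separated-⊆ X⊆ Y⊆ sep tightX′ tightY′ =
      sep (λ v v∈X → tightX′ v (X⊆ v∈X)) (λ v v∈Y → tightY′ v (Y⊆ v∈Y))

    NonNegativeOn : Subset n → Set ℓ
    NonNegativeOn X = ∀ v → v ∈ X → 0# ≤ᴿ weight v

    nonNegativeOn-∪⁅⁆ : ∀ {X v} → NonNegativeOn X → 0# ≤ᴿ weight v → NonNegativeOn (X ∪ ⁅ v ⁆)
    nonNegativeOn-∪⁅⁆ {X} {v} 0≤X 0≤v u u∈ with x∈p∪q⁻ X ⁅ v ⁆ u∈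
    ... | inj₁ u∈X  = 0≤X u u∈X
    ... | inj₂ u∈⁅v⁆ = subst (λ u → 0# ≤ᴿ weight u) (sym (x∈⁅y⁆⇒x≡y v u∈⁅v⁆)) 0≤v

    record Grouping (Xs : List (Subset n)) : Set (c ⊔ ℓ) where
      constructor grouping
      field
        tight       : All (λ X → ∃[ i ] TightOn i X) Xs
        separated   : AllPairs Separated Xs
        nonNegative : All NonNegativeOn Xs

    Labelled : Set c
    Labelled = ∃₂ λ X i → TightOn i X

    label : Labelled → Fin k
    label = proj₁ ∘ proj₂

    -- A repeated label would be tight on two separated groups. So the labels are distinct elements
    -- of `Fin k`, which limits the number of groups at every stage.
    labels-unique : ∀ {Xs} (tight : All (λ X → ∃[ i ] TightOn i X) Xs) →
                    AllPairs Separated Xs → Unique (map label (All.toList tight))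
    labels-unique []                      []           = []
    labels-unique ((i , iX) ∷ tight) (sep ∷ seps) = fresh tight sep ∷ labels-unique tight seps
      where
      fresh : ∀ {Ys} (tight : All (λ X → ∃[ i ] TightOn i X) Ys) → All (Separated _) Ys →
              All (i ≢_) (map label (All.toList tight))
      fresh []                 []         = []
      fresh ((j , jY) ∷ tight) (sep ∷ seps) = (λ { refl → sep iX jY }) ∷ fresh tight seps

    length-labels : ∀ {Xs} (tight : All (λ X → ∃[ i ] TightOn i X) Xs) →
                    length (map label (All.toList tight)) ≡ length Xs
    length-labels tight = trans (length-map label (All.toList tight))
      (trans (sym (length-map proj₁ (All.toList tight))) (cong length (map-proj₁-toList tight)))

    grouping-length≤ : ∀ {Xs} → Grouping Xs → length Xs ≤ k
    grouping-length≤ (grouping tight separated _) =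
      subst (_≤ k) (length-labels tight) (Unique⇒length≤ (labels-unique tight separated))

    -- Correctness and cost of the grouping.

    askAll-ensures : ∀ {m} (Xs : Fin m → Subset n) →
                     Ensures f m (askAll Xs) (λ xs → ∀ i → xs i ≡ f (Xs i))
    askAll-ensures {zero}  Xs = ensures-pure λ ()
    askAll-ensures {suc m} Xs =
      ensures-weaken (ℕ.≤-reflexive (cong suc (ℕ.+-identityʳ m))) id
        (ensures-bind (ensures-ask (Xs zero)) λ x x≡ →
         ensures-bind (askAll-ensures (Xs ∘ suc)) λ xs xs≡ →
         ensures-pure λ { zero → x≡ ; (suc i) → xs≡ i })

    module _ {w : Fin n → Carrier} (w≗weight : ∀ v → w v ≡ weight v) where

      -- `separated⁺` is stated for all `Z` for the sake of the induction: a group that rejects `v`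
      -- must stay separated from whatever the later groups become.
      record Inserted (v : Fin n) (Xs Ys : List (Subset n)) : Set (c ⊔ ℓ) where
        field
          isGrouping : Grouping Ys
          separated⁺ : ∀ {Z} → Separated Z ⁅ v ⁆ → All (Separated Z) Xs → All (Separated Z) Ys
          inserted   : Any (v ∈_) Ys
          preserved  : ∀ {u} → Any (u ∈_) Xs → Any (u ∈_) Ys

      insert-ensures : ∀ {v} Xs → 0# ≤ᴿ weight v → Grouping Xs →
                       Ensures f (length Xs) (insert w v Xs) (Inserted v Xs)
      insert-ensures {v} [] 0≤v _ = ensures-pure record
        { isGrouping = grouping ((_ , tight) ∷ []) ([] ∷ []) (nonNegative ∷ [])
        ; separated⁺ = λ sep _ → sep ∷ []
        ; inserted   = here (x∈⁅x⁆ v)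
        ; preserved  = λ ()
        }
        where
        i = proj₁ (attained ⁅ v ⁆)
        tight : TightOn i ⁅ v ⁆
        tight u u∈⁅v⁆ with refl ← x∈⁅y⁆⇒x≡y v u∈⁅v⁆ =
          trans (sym (⟦⟧-⁅⁆ (coeff i) v)) (proj₂ (attained ⁅ v ⁆))
        nonNegative : NonNegativeOn ⁅ v ⁆
        nonNegative u u∈⁅v⁆ with refl ← x∈⁅y⁆⇒x≡y v u∈⁅v⁆ = 0≤v
      insert-ensures {v} (X ∷ Xs) 0≤v (grouping (t ∷ ts) (s ∷ ss) (p ∷ ps)) =
        ensures-bind (ensures-ask (X ∪ ⁅ v ⁆)) λ x x≡ →
        ensures-if (x ≟ ⟦ w ⟧ (X ∪ ⁅ v ⁆))
          (λ x≡w → ensures-weaken ℕ.z≤n id (ensures-pure record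
            { isGrouping = grouping
                (f≡weight⇒tight (trans (sym x≡) (trans x≡w (w≡weight (X ∪ ⁅ v ⁆)))) ∷ ts)
                (All.map (separated-⊆ (p⊆p∪q ⁅ v ⁆) id) s ∷ ss)
                (nonNegativeOn-∪⁅⁆ p 0≤v ∷ ps)
            ; separated⁺ = λ { _ (sep ∷ seps) → separated-⊆ id (p⊆p∪q ⁅ v ⁆) sep ∷ seps }
            ; inserted   = here (q⊆p∪q X ⁅ v ⁆ (x∈⁅x⁆ v))
            ; preserved  = λ { (here u∈X) → here (p⊆p∪q ⁅ v ⁆ u∈X) ; (there u∈Xs) → there u∈Xs }
            }))
          (λ x≢w → ensures-weaken (ℕ.≤-reflexive (ℕ.+-identityʳ _)) id
            (ensures-bind (insert-ensures Xs 0≤v (grouping ts ss ps)) λ Ys Ys-ins →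
             let open Inserted Ys-ins
                 open Grouping isGrouping
             in ensures-pure record
               { isGrouping = grouping
                   (t ∷ tight)
                   (separated⁺ (X-separated x≡ x≢w) s ∷ separated)
                   (p ∷ nonNegative)
               ; separated⁺ = λ { sep (sepX ∷ sepXs) → sepX ∷ separated⁺ sep sepXs }
               ; inserted   = there inserted
               ; preserved  = λ { (here u∈X) → here u∈X ; (there u∈Xs) → there (preserved u∈Xs) }
               }))
        where
        w≡weight : ∀ Y → ⟦ w ⟧ Y ≡ ⟦ weight ⟧ Y
        w≡weight Y = ⟦⟧-cong Y (λ v _ → w≗weight v)
        -- A function tight on both sets would be tight on their union, and the test would have
        -- succeeded.
        X-separated : ∀ {x} → x ≡ f (X ∪ ⁅ v ⁆) → x ≢ ⟦ w ⟧ (X ∪ ⁅ v ⁆) → Separated X ⁅ v ⁆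
        X-separated x≡ x≢w iX iv =
          x≢w (trans x≡ (trans (tight⇒f≡weight (tightOn-∪ iX iv)) (sym (w≡weight (X ∪ ⁅ v ⁆)))))

      record Grouped (Xs : List (Subset n)) (vs : List (Fin n)) (Ys : List (Subset n)) :
                     Set (c ⊔ ℓ) where
        constructor grouped
        field
          isGrouping : Grouping Ys
          preserved  : ∀ {u} → Any (u ∈_) Xs → Any (u ∈_) Ys
          covers     : ∀ {u} → u List.∈ vs → ¬ weight u ≤ᴿ 0# → Any (u ∈_) Ys

      group-ensures : ∀ vs {Xs} → Grouping Xs →
                      Ensures f (length vs * k) (group w vs Xs) (Grouped Xs vs)
      group-ensures []       Xs-grouping = ensures-pure (grouped Xs-grouping id λ ())
      group-ensures (v ∷ vs) {Xs} Xs-grouping =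
        ensures-bind step λ Ys (Ys-grouping , Xs⊆Ys , v∈Ys) →
        ensures-weaken ℕ.≤-refl
          (λ (grouped Zs-grouping Ys⊆Zs vs∈Zs) → grouped Zs-grouping (Ys⊆Zs ∘ Xs⊆Ys)
            λ { (here refl) v≰0 → Ys⊆Zs (v∈Ys v≰0) ; (there u∈vs) → vs∈Zs u∈vs })
          (group-ensures vs Ys-grouping)
        where
        w≡ = w≗weight v
        step : Ensures f k (if does (w v ≤? 0#) then pure Xs else insert w v Xs)
                 (λ Ys → Grouping Ys × (∀ {u} → Any (u ∈_) Xs → Any (u ∈_) Ys) ×
                         (¬ weight v ≤ᴿ 0# → Any (v ∈_) Ys))
        step = ensures-if (w v ≤? 0#)
          (λ w≤0 → ensures-weaken ℕ.z≤n id
            (ensures-pure (Xs-grouping , id , contradiction (subst (_≤ᴿ 0#) w≡ w≤0))))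
          -- An insertion costs at most one query per present group, hence at most `k`.
          (λ w≰0 → ensures-weaken (grouping-length≤ Xs-grouping)
            (λ Ys-ins → let open Inserted Ys-ins in isGrouping , preserved , λ _ → inserted)
            (insert-ensures Xs
              ([ subst (0# ≤ᴿ_) w≡ , (λ w≤0 → contradiction w≤0 w≰0) ]′ (≤-total 0# (w v)))
              Xs-grouping))

    -- Ascents from the groups.

    -- The ascent from X has seen S and stands at Y, where fᵢ attains f; f Y is
    -- compared with what the function fⱼ could have gained within S.
    record Ascent (j : Fin k) (X : Subset n) (i : Fin k) (Y S : Subset n) : Set (c ⊔ ℓ) where
      field
        start⊆seen   : X ⊆ S
        current⊆seen : Y ⊆ S
        gain≤        : ⟦ coeff⁺ j ⟧ S ≤ᴿ f Y
        attains      : Attains i Y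

    -- The two useful ends of an ascent: a function other than `fs j` has taken over, or everything
    -- has been seen and `gain≤` bounds all of `sum (coeff⁺ j)`.
    Outcome : Fin k → Subset n → Subset n → Set (c ⊔ ℓ)
    Outcome j X Y = ∃₂ λ i S → Ascent j X i Y S × (i ≢ j ⊎ (∀ v → v ∈ S))

    -- On a tight group with nonnegative weights `coeff j`, `coeff⁺ j` and `weight` agree, so the
    -- gain inequality starts as an equality.
    ascent-start : ∀ {j X} → TightOn j X → NonNegativeOn X → Ascent j X j X X
    ascent-start {j} {X} tight 0≤X = record
      { start⊆seen   = id
      ; current⊆seen = id
      ; gain≤        = ≤-reflexive (trans (⟦⟧-cong X coeff⁺≡weight) (sym fX≡weight))
      ; attains      = trans (⟦⟧-cong X tight) (sym fX≡weight)
      }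
      where
      fX≡weight = tight⇒f≡weight tight
      coeff⁺≡weight : ∀ v → v ∈ X → coeff⁺ j v ≡ weight v
      coeff⁺≡weight v v∈X = trans (cong (_⊔ᴿ 0#) (tight v v∈X)) (x≤y⇒y⊔x≈y (0≤X v v∈X))

    -- While `fs j` attains `f Y`, adding an unseen `v` gives at least `f Y + coeff j v`, and
    -- staying at `Y` gives `f Y`; the better choice gains `coeff⁺ j v`. A seen `v` is already
    -- counted in `S`. The function attaining `f Y′` may be a different one, which ends the argument
    -- for `j`.
    ascent-step : ∀ {j X Y S v Y′} → Ascent j X j Y S →
                  Y′ ⊆ Y ∪ ⁅ v ⁆ → f Y ≤ᴿ f Y′ → f (Y ∪ ⁅ v ⁆) ≤ᴿ f Y′ →
                  ∃₂ λ i S′ → Ascent j X i Y′ S′ × S ⊆ S′ × v ∈ S′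
    ascent-step {j} {X} {Y} {S} {v} {Y′} asc Y′⊆ fY≤ fY∪v≤
      with i , iY′ ← attained Y′ with v ∈? S
    ... | yes v∈S = i , S , record
      { start⊆seen   = start⊆seen
      ; current⊆seen = λ u∈Y′ → [ current⊆seen , v⊆S ]′ (x∈p∪q⁻ Y ⁅ v ⁆ (Y′⊆ u∈Y′))
      ; gain≤        = ≤-trans gain≤ fY≤
      ; attains      = iY′
      } , id , v∈S
      where
      open Ascent asc
      v⊆S : ⁅ v ⁆ ⊆ S
      v⊆S u∈⁅v⁆ = subst (_∈ S) (sym (x∈⁅y⁆⇒x≡y v u∈⁅v⁆)) v∈S
    ... | no  v∉S = i , S ∪ ⁅ v ⁆ , record
      { start⊆seen   = p⊆p∪q ⁅ v ⁆ ∘ start⊆seen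
      ; current⊆seen = λ u∈Y′ → x∈p∪q⁺ (⊎.map₁ current⊆seen (x∈p∪q⁻ Y ⁅ v ⁆ (Y′⊆ u∈Y′)))
      ; gain≤        = begin
          ⟦ coeff⁺ j ⟧ (S ∪ ⁅ v ⁆)     ≡⟨ ⟦⟧-∪-⁅⁆ (coeff⁺ j) v∉S ⟩
          ⟦ coeff⁺ j ⟧ S + coeff⁺ j v  ≤⟨ +-monoˡ-≤ _ gain≤ ⟩
          f Y + coeff⁺ j v             ≤⟨ fY+coeff⁺≤ ⟩
          f Y′                         ∎
      ; attains      = iY′
      } , p⊆p∪q ⁅ v ⁆ , q⊆p∪q S ⁅ v ⁆ (x∈⁅x⁆ v)
      where
      open Ascent asc
      open ≤-Reasoning
      fY+coeff≤ : f Y + coeff j v ≤ᴿ f Y′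
      fY+coeff≤ = begin
        f Y + coeff j v              ≡⟨ cong (_+ coeff j v) attains ⟨
        ⟦ coeff j ⟧ Y + coeff j v    ≡⟨ ⟦⟧-∪-⁅⁆ (coeff j) (v∉S ∘ current⊆seen) ⟨
        ⟦ coeff j ⟧ (Y ∪ ⁅ v ⁆)      ≤⟨ coeff≤f j (Y ∪ ⁅ v ⁆) ⟩
        f (Y ∪ ⁅ v ⁆)                ≤⟨ fY∪v≤ ⟩
        f Y′                         ∎
      fY+coeff⁺≤ : f Y + coeff⁺ j v ≤ᴿ f Y′
      fY+coeff⁺≤ with ⊔-sel (coeff j v) 0#
      ... | inj₁ ≡coeff = subst (λ x → f Y + x ≤ᴿ f Y′) (sym ≡coeff) fY+coeff≤
      ... | inj₂ ≡0     = subst (_≤ᴿ f Y′) (sym (trans (cong (f Y +_) ≡0) (+-identityʳ _))) fY≤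

    -- The run does not depend on `j`, so one list of sets serves every `j`, `X` and `S` for which
    -- an ascent may stand at `Y`.
    record Ascended (Y : Subset n) (vs : List (Fin n)) (Zs : List (Subset n)) : Set (c ⊔ ℓ) where
      constructor ascended
      field
        length-≡ : length Zs ≡ suc (length vs)
        start∈   : Y List.∈ Zs
        outcome  : ∀ {j X S} → Ascent j X j Y S → (∀ v → v ∈ S ⊎ v List.∈ vs) →
                   Any (Outcome j X) Zs

    ascend-ensures : ∀ Y vs → Ensures f (length vs * 2) (ascend Y vs) (Ascended Y vs)
    ascend-ensures Y [] = ensures-pure (ascended refl (here refl) λ {j} {S = S} asc seen →
      here (j , S , asc , inj₂ λ v → [ id , (λ ()) ]′ (seen v)))
    ascend-ensures Y (v ∷ vs) =
      ensures-bind (ensures-ask Y) λ y y≡ →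
      ensures-bind (ensures-ask (Y ∪ ⁅ v ⁆)) λ z z≡ →
      continue (z ≤? y) y≡ z≡
      where
      combine : ∀ {Y′ Zs} → Y′ ⊆ Y ∪ ⁅ v ⁆ → f Y ≤ᴿ f Y′ → f (Y ∪ ⁅ v ⁆) ≤ᴿ f Y′ →
                Ascended Y′ vs Zs → Ascended Y (v ∷ vs) (Y ∷ Zs)
      combine {Y′} {Zs} Y′⊆ fY≤ fY∪v≤ (ascended len Y′∈ out) =
        ascended (cong suc len) (here refl) λ asc seen → there (outcome asc seen)
        where
        outcome : ∀ {j X S} → Ascent j X j Y S → (∀ u → u ∈ S ⊎ u List.∈ v ∷ vs) →
                  Any (Outcome j X) Zs
        outcome {j} {X} asc seen with ascent-step asc Y′⊆ fY≤ fY∪v≤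
        ... | i , S′ , asc′ , S⊆S′ , v∈S′ with i ≟ᶠ j
        ...   | yes refl = out asc′ λ u → later (seen u)
          where
          later : ∀ {u} → u ∈ _ ⊎ u List.∈ v ∷ vs → u ∈ S′ ⊎ u List.∈ vs
          later (inj₁ u∈S)          = inj₁ (S⊆S′ u∈S)
          later (inj₂ (here refl))  = inj₁ v∈S′
          later (inj₂ (there u∈vs)) = inj₂ u∈vs
        -- The first change of the attaining function settles the outcome. `Y′` is listed because
        -- the remaining ascent starts there.
        ...   | no  i≢j  = lose Y′∈ (i , S′ , asc′ , inj₁ i≢j)
      continue : ∀ {y z} (z≤?y : Dec (z ≤ᴿ y)) → y ≡ f Y → z ≡ f (Y ∪ ⁅ v ⁆) →
                 Ensures f (length vs * 2)
                   (ascend (if does z≤?y then Y else Y ∪ ⁅ v ⁆) vs >>= λ Zs → pure (Y ∷ Zs))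
                   (Ascended Y (v ∷ vs))
      continue (yes z≤y) refl refl = ensures-weaken (ℕ.≤-reflexive (ℕ.+-identityʳ _)) id
        (ensures-bind (ascend-ensures Y vs) λ Zs →
         ensures-pure ∘ combine (p⊆p∪q ⁅ v ⁆) ≤-refl z≤y)
      continue (no z≰y) refl refl = ensures-weaken (ℕ.≤-reflexive (ℕ.+-identityʳ _)) id
        (ensures-bind (ascend-ensures (Y ∪ ⁅ v ⁆) vs) λ Zs →
         ensures-pure ∘ combine id ([ id , (λ z≤y → contradiction z≤y z≰y) ]′ (≤-total _ _)) ≤-refl)

    record AscendedAll (Xs Zs : List (Subset n)) : Set (c ⊔ ℓ) where
      constructor ascendedAll
      field
        length-≡ : length Zs ≡ length Xs * suc n
        starts∈  : All (List._∈ Zs) Xs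
        outcomes : All (λ X → ∀ j → TightOn j X → NonNegativeOn X → Any (Outcome j X) Zs) Xs

    ascendAll-ensures : ∀ Xs → Ensures f (length Xs * (n * 2)) (ascendAll Xs) (AscendedAll Xs)
    ascendAll-ensures []       = ensures-pure (ascendedAll refl [] [])
    ascendAll-ensures (X ∷ Xs) =
      ensures-weaken (ℕ.≤-reflexive (cong₂ ℕ._+_ (cong (_* 2) |allFin|≡n) (ℕ.+-identityʳ _))) id
        (ensures-bind (ascend-ensures X (allFin n)) λ Ys (ascended lenY X∈Ys out) →
         ensures-bind (ascendAll-ensures Xs) λ Zs (ascendedAll lenZ Xs∈Zs outs) →
         ensures-pure (ascendedAll
           (trans (length-++ Ys) (cong₂ ℕ._+_ (trans lenY (cong suc |allFin|≡n)) lenZ))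
           (∈-++⁺ˡ X∈Ys ∷ All.map (∈-++⁺ʳ Ys) Xs∈Zs)
           ((λ j tight 0≤X → AnyP.++⁺ˡ (out (ascent-start tight 0≤X) (λ v → inj₂ (∈-allFin v))))
             ∷ All.map (λ out j tight 0≤X → AnyP.++⁺ʳ Ys (out j tight 0≤X)) outs)))
      where
      |allFin|≡n : length (allFin n) ≡ n
      |allFin|≡n = length-tabulate id

    -- The best candidate and the approximation ratio.

    best-ensures : ∀ X Ys → Ensures f (length Ys * 2) (best X Ys)
                              (λ Z → f X ≤ᴿ f Z × All (λ Y → f Y ≤ᴿ f Z) Ys)
    best-ensures X []       = ensures-pure (≤-refl , [])
    best-ensures X (Y ∷ Ys) =
      ensures-bind (ensures-ask X) λ x x≡ →
      ensures-bind (ensures-ask Y) λ y y≡ →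
      continue (x ≤? y) x≡ y≡
      where
      continue : ∀ {x y} (x≤?y : Dec (x ≤ᴿ y)) → x ≡ f X → y ≡ f Y →
                 Ensures f (length Ys * 2) (best (if does x≤?y then Y else X) Ys)
                   (λ Z → f X ≤ᴿ f Z × All (λ Y → f Y ≤ᴿ f Z) (Y ∷ Ys))
      continue (yes x≤y) refl refl = ensures-weaken ℕ.≤-refl
        (λ (Y≤Z , Ys≤Z) → ≤-trans x≤y Y≤Z , Y≤Z ∷ Ys≤Z) (best-ensures Y Ys)
      continue (no x≰y) refl refl = ensures-weaken ℕ.≤-refl
        (λ (X≤Z , Ys≤Z) → X≤Z , ≤-trans Y≤X X≤Z ∷ Ys≤Z)
        (best-ensures X Ys)
        where
        Y≤X : f Y ≤ᴿ f X
        Y≤X = [ (λ x≤y → contradiction x≤y x≰y) , id ]′ (≤-total (f X) (f Y))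

    -- The value of `fs i` on `Y ∪ Z` contains both contributions: `fs i` attains `f Y`, it is tight
    -- on `Z`, and `Z ─ S` avoids `Y` because `Y ⊆ S`. The other elements of `Z` outside `Y` add
    -- nonnegative amounts.
    ascent-gain : ∀ {j X i Y S Z} → Ascent j X i Y S → TightOn i Z → NonNegativeOn Z →
                  ⟦ coeff⁺ j ⟧ S + ⟦ weight⁺ ⟧ (Z ─ S) ≤ᴿ f (Y ∪ Z)
    ascent-gain {j} {X} {i} {Y} {S} {Z} asc tight 0≤Z = begin
      ⟦ coeff⁺ j ⟧ S + ⟦ weight⁺ ⟧ (Z ─ S)   ≤⟨ +-monoˡ-≤ _ gain≤ ⟩
      f Y + ⟦ weight⁺ ⟧ (Z ─ S)              ≡⟨ cong (_+ _) attains ⟨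
      ⟦ coeff i ⟧ Y + ⟦ weight⁺ ⟧ (Z ─ S)    ≡⟨ ∑-distrib-+ (restrict Y (coeff i)) _ ⟨
      sum (λ v → restrict Y (coeff i) v + restrict (Z ─ S) weight⁺ v)
                                             ≤⟨ sum-mono-≤ pointwise ⟩
      ⟦ coeff i ⟧ (Y ∪ Z)                    ≤⟨ coeff≤f i (Y ∪ Z) ⟩
      f (Y ∪ Z)                              ∎
      where
      open ≤-Reasoning
      open Ascent asc
      open Sum +-commutativeMonoid using (∑-distrib-+)
      weight⁺≡coeff : ∀ {v} → v ∈ Z → weight⁺ v ≡ coeff i v
      weight⁺≡coeff v∈Z = trans (x≤y⇒y⊔x≈y (0≤Z _ v∈Z)) (sym (tight _ v∈Z))
      ∉─ : ∀ {v} → v ∈ S → v ∉ Z ─ S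
      ∉─ v∈S v∈Z─S = x∈p─q⇒x∉q Z S v∈Z─S v∈S
      pointwise : ∀ v → restrict Y (coeff i) v + restrict (Z ─ S) weight⁺ v ≤ᴿ
                        restrict (Y ∪ Z) (coeff i) v
      pointwise v with v ∈? Y | v ∈? Z
      ... | yes v∈Y | _
        rewrite restrict-∈ (coeff i) v∈Y | restrict-∉ weight⁺ (∉─ (current⊆seen v∈Y))
              | restrict-∈ {X = Y ∪ Z} (coeff i) (x∈p∪q⁺ (inj₁ v∈Y))
        = ≤-reflexive (+-identityʳ _)
      ... | no  v∉Y | no  v∉Z
        rewrite restrict-∉ (coeff i) v∉Y | restrict-∉ {X = Z ─ S} weight⁺ (v∉Z ∘ p─q⊆p Z S)
              | restrict-∉ {X = Y ∪ Z} (coeff i) ([ v∉Y , v∉Z ]′ ∘ x∈p∪q⁻ Y Z)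
        = ≤-reflexive (+-identityʳ _)
      ... | no  v∉Y | yes v∈Z
        rewrite restrict-∉ (coeff i) v∉Y | +-identityˡ (restrict (Z ─ S) weight⁺ v)
              | restrict-∈ {X = Y ∪ Z} (coeff i) (x∈p∪q⁺ (inj₂ v∈Z)) | sym (weight⁺≡coeff v∈Z)
        = restrict≤ v
        where
        restrict≤ : ∀ v → restrict (Z ─ S) weight⁺ v ≤ᴿ weight⁺ v
        restrict≤ v with lookup (Z ─ S) v
        ... | true  = ≤-refl
        ... | false = 0≤weight⁺ v

    coeff⁺≤0 : ∀ j {v} → weight v ≤ᴿ 0# → coeff⁺ j v ≤ᴿ 0#
    coeff⁺≤0 j {v} w≤0 = ≤-trans (coeff⁺≤weight⁺ j v) (⊔-lub w≤0 ≤-refl)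

    -- If the ascent ends in Y with value fᵢ, the group Z labelled by i extends it
    -- additively, so that f (Y ∪ Z) pays for S ∪ Z and only the groups Xs remain.
    ascent-bound : ∀ {j X i Y S Z x} → Ascent j X i Y S → TightOn i Z → NonNegativeOn Z →
                   f (Y ∪ Z) ≤ᴿ x → ∀ Xs → All (λ X → ⟦ weight⁺ ⟧ X ≤ᴿ x) Xs →
                   (∀ v → v ∈ S ⊎ v ∈ Z ⊎ Any (v ∈_) Xs ⊎ weight v ≤ᴿ 0#) →
                   sum (coeff⁺ j) ≤ᴿ suc (length Xs) · x
    ascent-bound {j} {S = S} {Z} {x} asc tight 0≤Z fY∪Z≤x Xs Xs≤x cover = begin
      sum (coeff⁺ j)                ≤⟨ cover-bound Xs 0≤weight⁺ (coeff⁺≤weight⁺ j) 0≤h cover′ Xs≤x ⟩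
      sum h + length Xs · x         ≡⟨ cong (_+ _) (∑-distrib-+ (restrict S (coeff⁺ j)) _) ⟩
      ⟦ coeff⁺ j ⟧ S + ⟦ weight⁺ ⟧ (Z ─ S) + length Xs · x
                                    ≤⟨ +-monoˡ-≤ _ (≤-trans (ascent-gain asc tight 0≤Z) fY∪Z≤x) ⟩
      x + length Xs · x             ∎
      where
      open ≤-Reasoning
      open Sum +-commutativeMonoid using (∑-distrib-+)
      h : Fin n → Carrier
      h v = restrict S (coeff⁺ j) v + restrict (Z ─ S) weight⁺ v
      0≤S : ∀ v → 0# ≤ᴿ restrict S (coeff⁺ j) v
      0≤S = restrict-nonNegative S (0≤coeff⁺ j)
      0≤Z─S : ∀ v → 0# ≤ᴿ restrict (Z ─ S) weight⁺ v
      0≤Z─S = restrict-nonNegative (Z ─ S) 0≤weight⁺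
      0≤h : ∀ v → 0# ≤ᴿ h v
      0≤h v = +-nonNegative (0≤S v) (0≤Z─S v)
      cover′ : ∀ v → coeff⁺ j v ≤ᴿ h v ⊎ Any (v ∈_) Xs
      cover′ v with v ∈? S
      ... | yes v∈S = inj₁ (begin
        coeff⁺ j v                       ≡⟨ restrict-∈ (coeff⁺ j) v∈S ⟨
        restrict S (coeff⁺ j) v          ≡⟨ +-identityʳ _ ⟨
        restrict S (coeff⁺ j) v + 0#     ≤⟨ +-mono-≤ ≤-refl (0≤Z─S v) ⟩
        h v                              ∎)
      ... | no  v∉S with cover v
      ...   | inj₁ v∈S                = contradiction v∈S v∉S
      ...   | inj₂ (inj₂ (inj₁ v∈Xs)) = inj₂ v∈Xs
      ...   | inj₂ (inj₂ (inj₂ w≤0))  = inj₁ (≤-trans (coeff⁺≤0 j w≤0) (0≤h v))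
      ...   | inj₂ (inj₁ v∈Z)         = inj₁ (begin
        coeff⁺ j v                       ≤⟨ coeff⁺≤weight⁺ j v ⟩
        weight⁺ v                        ≡⟨ restrict-∈ weight⁺ (x∈p∧x∉q⇒x∈p─q v∈Z v∉S) ⟨
        restrict (Z ─ S) weight⁺ v       ≡⟨ +-identityˡ _ ⟨
        0# + restrict (Z ─ S) weight⁺ v  ≤⟨ +-monoˡ-≤ _ (0≤S v) ⟩
        h v                              ∎)

    groups-bound : ∀ {x} j Xs → All (λ X → ⟦ weight⁺ ⟧ X ≤ᴿ x) Xs →
                   (∀ v → Any (v ∈_) Xs ⊎ weight v ≤ᴿ 0#) →
                   sum (coeff⁺ j) ≤ᴿ length Xs · x
    groups-bound {x} j Xs Xs≤x cover = begin
      sum (coeff⁺ j)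
        ≤⟨ cover-bound Xs 0≤weight⁺ (coeff⁺≤weight⁺ j) (λ _ → ≤-refl)
             (λ v → ⊎.swap (⊎.map₂ (coeff⁺≤0 j) (cover v))) Xs≤x ⟩
      sum {n} (λ _ → 0#) + length Xs · x
        ≡⟨ cong (_+ length Xs · x) (sum-replicate-zero n) ⟩
      0# + length Xs · x
        ≡⟨ +-identityˡ _ ⟩
      length Xs · x
        ∎
      where
      open ≤-Reasoning
      open Sum +-commutativeMonoid using (sum-replicate-zero)

    module _ {x : Carrier} (0≤x : 0# ≤ᴿ x) (ps : List Labelled) (ps! : Unique (map label ps))
             (nonNegative : All (λ p → NonNegativeOn (proj₁ p)) ps)
             (ps≤x : All (λ p → ⟦ weight⁺ ⟧ (proj₁ p) ≤ᴿ x) ps)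
             (cover : ∀ v → Any (λ p → v ∈ proj₁ p) ps ⊎ weight v ≤ᴿ 0#) where

      unlabelled-bound : ∀ {i} → ¬ i List.∈ map label ps → ∀ j → sum (coeff⁺ j) ≤ᴿ (k ∸ 1) · x
      unlabelled-bound {i} i∉ j = begin
        sum (coeff⁺ j)             ≤⟨ groups-bound j (map proj₁ ps) (AllP.map⁺ ps≤x)
                                        (⊎.map₁ AnyP.map⁺ ∘ cover) ⟩
        length (map proj₁ ps) · x  ≡⟨ cong (_· x) (length-map proj₁ ps) ⟩
        length ps · x              ≡⟨ cong (_· x) (length-map label ps) ⟨
        length (map label ps) · x  ≤⟨ ·-monoˡ-≤ 0≤x (ℕ.∸-monoˡ-≤ 1 1+labels≤k) ⟩
        (k ∸ 1) · x                ∎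
        where
        open ≤-Reasoning
        1+labels≤k : suc (length (map label ps)) ≤ k
        1+labels≤k = Unique⇒length≤ (AllP.¬Any⇒All¬ _ i∉ ∷ ps!)

      -- In the main case one candidate `Y ∪ Z` pays for two distinct groups, `X` and `Z`, and at
      -- most `k - 2` groups remain.
      labelled-bound : 2 ≤ k → ∀ {p Y} → p List.∈ ps → Outcome (label p) (proj₁ p) Y →
                       All (λ q → f (Y ∪ proj₁ q) ≤ᴿ x) ps →
                       sum (coeff⁺ (label p)) ≤ᴿ (k ∸ 1) · x
      labelled-bound 2≤k {X , j , tight} p∈ps (i , S , asc , leaves) Y∪ps≤x with i ≟ᶠ j | leaves
      ... | yes refl | inj₁ i≢j = contradiction refl i≢j
      -- Everything has been seen, so the group `X` itself can serve as `Z` with no groups left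
      -- over. The resulting factor 1 is at most `k ∸ 1` by `2 ≤ k`.
      ... | yes refl | inj₂ full = ≤-trans
        (ascent-bound asc tight (All.lookup nonNegative p∈ps) (All.lookup Y∪ps≤x p∈ps)
          [] [] (inj₁ ∘ full))
        (·-monoˡ-≤ 0≤x (ℕ.∸-monoˡ-≤ 1 2≤k))
      ... | no  i≢j  | _ with i ∈?ᶠ map label ps
      ...   | no  i∉ = unlabelled-bound i∉ j
      ...   | yes i∈
        with (Z , _ , tightZ) , q∈ps , refl ← ∈-map⁻ label i∈
        -- The groups labelled `j` and `i` are moved to the front; they are different since `i ≢ j`.
        with ps′ , ps↭p∷ps′ ← ∈⇒↭∷ p∈ps
        with ∈-resp-↭ ps↭p∷ps′ q∈ps
      ...     | here refl = contradiction refl i≢j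
      ...     | there q∈ps′ with rest , ps′↭q∷rest ← ∈⇒↭∷ q∈ps′ = begin
        sum (coeff⁺ j)
          ≤⟨ ascent-bound asc tightZ (All.lookup nonNegative q∈ps) (All.lookup Y∪ps≤x q∈ps)
               (map proj₁ rest) (AllP.map⁺ (All.tail (All.tail (All-resp-↭ ps↭ ps≤x)))) remaining ⟩
        suc (length (map proj₁ rest)) · x
          ≡⟨ cong (λ m → suc m · x) (length-map proj₁ rest) ⟩
        suc (length rest) · x
          ≤⟨ ·-monoˡ-≤ 0≤x (ℕ.∸-monoˡ-≤ 1 2+rest≤k) ⟩
        (k ∸ 1) · x
          ∎
        where
        open ≤-Reasoning
        ps↭ = ↭-trans ps↭p∷ps′ (prep _ ps′↭q∷rest)
        2+rest≤k : 2 ℕ.+ length rest ≤ k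
        2+rest≤k = subst (_≤ k) (trans (length-map label ps) (↭-length ps↭)) (Unique⇒length≤ ps!)
        remaining : ∀ v → v ∈ S ⊎ v ∈ Z ⊎ Any (v ∈_) (map proj₁ rest) ⊎ weight v ≤ᴿ 0#
        remaining v with cover v
        ... | inj₂ w≤0  = inj₂ (inj₂ (inj₂ w≤0))
        ... | inj₁ v∈ps with Any-resp-↭ ps↭ v∈ps
        ...   | here v∈X              = inj₁ (Ascent.start⊆seen asc v∈X)
        ...   | there (here v∈Z)      = inj₂ (inj₁ v∈Z)
        ...   | there (there v∈rest)  = inj₂ (inj₂ (inj₁ (AnyP.map⁺ v∈rest)))

    coeff⁺-bound : ∀ {Xs Zs x} → 2 ≤ k → 0# ≤ᴿ x → Grouping Xs →
                   (∀ v → Any (v ∈_) Xs ⊎ weight v ≤ᴿ 0#) → AscendedAll Xs Zs →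
                   (∀ {Y Z} → Y List.∈ Zs → Z List.∈ Xs → f (Y ∪ Z) ≤ᴿ x) →
                   ∀ j → sum (coeff⁺ j) ≤ᴿ (k ∸ 1) · x
    coeff⁺-bound {Xs} {Zs} {x} 2≤k 0≤x (grouping tight separated nonNegative) cover
                 (ascendedAll _ starts∈ outcomes) ∪≤x
      with ps! ← labels-unique tight separated
      -- `Xs` is replaced by the first projections of the labelled list `ps`, so that sets and
      -- labels are permuted together.
      with ps ← All.toList tight | refl ← map-proj₁-toList tight
      = bound
      where
      0≤ps : All (λ p → NonNegativeOn (proj₁ p)) ps
      0≤ps = AllP.map⁻ nonNegative
      cover-ps : ∀ v → Any (λ p → v ∈ proj₁ p) ps ⊎ weight v ≤ᴿ 0#
      cover-ps = ⊎.map₁ AnyP.map⁻ ∘ cover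
      ps≤x : All (λ p → ⟦ weight⁺ ⟧ (proj₁ p) ≤ᴿ x) ps
      ps≤x = All.tabulate λ {(X , _ , tightX)} p∈ps → begin
        ⟦ weight⁺ ⟧ X  ≡⟨ ⟦⟧-cong X (λ v v∈X → x≤y⇒y⊔x≈y (All.lookup 0≤ps p∈ps v v∈X)) ⟩
        ⟦ weight ⟧ X   ≡⟨ tight⇒f≡weight tightX ⟨
        -- The ascent from `X` lists `X` itself, so `X ∪ X` is among the candidates.
        f X            ≡⟨ cong f (∪-idem X) ⟨
        f (X ∪ X)      ≤⟨ ∪≤x (All.lookup (AllP.map⁻ starts∈) p∈ps) (∈-map⁺ proj₁ p∈ps) ⟩
        x              ∎
        where open ≤-Reasoning
      bound : ∀ j → sum (coeff⁺ j) ≤ᴿ (k ∸ 1) · x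
      bound j with j ∈?ᶠ map label ps
      ... | no  j∉ = unlabelled-bound 0≤x ps ps! 0≤ps ps≤x cover-ps j∉ j
      ... | yes j∈
        with (X , _ , tightX) , p∈ps , refl ← ∈-map⁻ label j∈
        with Y , Y∈Zs , outcome ←
               find (All.lookup (AllP.map⁻ outcomes) p∈ps j tightX (All.lookup 0≤ps p∈ps))
        = labelled-bound 0≤x ps ps! 0≤ps ps≤x cover-ps 2≤k p∈ps outcome
            (All.tabulate (∪≤x Y∈Zs ∘ ∈-map⁺ proj₁))

    -- Correctness and the number of oracle calls.

    f≤sum-coeff⁺ : ∀ X → ∃[ j ] f X ≤ᴿ sum (coeff⁺ j)
    f≤sum-coeff⁺ X with j , jX ← attained X = j , (begin
      f X              ≡⟨ jX ⟨
      ⟦ coeff j ⟧ X    ≤⟨ sum-mono-≤ (restrict-mono-≤ X (λ v → x≤x⊔y (coeff j v) 0#)) ⟩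
      ⟦ coeff⁺ j ⟧ X   ≤⟨ ⟦⟧≤sum X (0≤coeff⁺ j) ⟩
      sum (coeff⁺ j)   ∎)
      where open ≤-Reasoning

    0≤f⊥ : 2 ≤ k → 0# ≤ᴿ f ⊥
    0≤f⊥ (ℕ.s≤s _) = subst (_≤ᴿ f ⊥) (⟦⟧-⊥ (coeff zero)) (coeff≤f zero ⊥)

    -- The cost has one summand per phase: the singletons; at most `k` tests for each element; two
    -- queries per element in each of at most `k` ascents; two queries for each of at most
    -- `k * suc n * k` unions.
    maximize-ensures :
      2 ≤ k →
      Ensures f (n ℕ.+ (n * k ℕ.+ (k * (n * 2) ℕ.+ k * suc n * k * 2)))
        (askAll ⁅_⁆ >>= λ w → group w (allFin n) [] >>= λ Xs →
         ascendAll Xs >>= λ Ys → best ⊥ (cartesianProductWith _∪_ Ys Xs))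
        (λ Z → ∀ Y → f Y ≤ᴿ (k ∸ 1) · f Z)
    maximize-ensures 2≤k =
      ensures-bind (askAll-ensures ⁅_⁆) λ w w≗weight →
      ensures-bind (ensures-weaken (ℕ.≤-reflexive (cong (_* k) (length-tabulate {n = n} id))) id
                     (group-ensures w≗weight (allFin n) (grouping [] [] [])))
        λ Xs (grouped Xs-grouping _ covers) →
      let m≤k = grouping-length≤ Xs-grouping in
      ensures-bind (ensures-weaken (ℕ.*-monoˡ-≤ (n * 2) m≤k) id (ascendAll-ensures Xs))
        λ Zs Zs-ascended →
      ensures-weaken
        (ℕ.*-monoˡ-≤ 2 (begin
          length (cartesianProductWith _∪_ Zs Xs)
            ≡⟨ length-cartesianProductWith _∪_ Zs Xs ⟩
          length Zs * length Xs
            ≡⟨ cong (_* length Xs) (AscendedAll.length-≡ Zs-ascended) ⟩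
          length Xs * suc n * length Xs
            ≤⟨ ℕ.*-mono-≤ (ℕ.*-monoˡ-≤ (suc n) m≤k) m≤k ⟩
          k * suc n * k
            ∎))
        (λ {Z} (f⊥≤fZ , candidates≤fZ) Y →
          let j , fY≤ = f≤sum-coeff⁺ Y in
          ≤-trans fY≤ (coeff⁺-bound 2≤k (≤-trans (0≤f⊥ 2≤k) f⊥≤fZ)
            Xs-grouping (cover covers) Zs-ascended
            (λ Y∈Zs Z∈Xs → All.lookup candidates≤fZ (∈-cartesianProductWith⁺ _∪_ Y∈Zs Z∈Xs)) j))
        (best-ensures ⊥ (cartesianProductWith _∪_ Zs Xs))
      where
      open ℕ.≤-Reasoning
      cover : ∀ {Xs} → (∀ {u} → u List.∈ allFin n → ¬ weight u ≤ᴿ 0# → Any (u ∈_) Xs) →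
              ∀ v → Any (v ∈_) Xs ⊎ weight v ≤ᴿ 0#
      cover covers v with weight v ≤? 0#
      ... | yes w≤0 = inj₂ w≤0
      ... | no  w≰0 = inj₁ (covers (∈-allFin v) w≰0)

  -- With `N = k ^ 2 * n` the phases cost at most `N`, `N`, `2 * N` and `4 * N`, whence the constant
  -- 8. The hypothesis `1 ≤ n` gives `suc n ≤ n + n` in the last of them.
  calls-bound : ∀ k n → 2 ≤ k → 1 ≤ n →
                n ℕ.+ (n * k ℕ.+ (k * (n * 2) ℕ.+ k * suc n * k * 2)) ≤ 8 * (k ^ 2 * n)
  calls-bound k@(suc _) n _ 1≤n = begin
    n ℕ.+ (n * k ℕ.+ (k * (n * 2) ℕ.+ k * suc n * k * 2))
      ≤⟨ ℕ.+-mono-≤ n≤N (ℕ.+-mono-≤ n*k≤N (ℕ.+-mono-≤ k*[n*2]≤2*N k*[1+n]*k*2≤4*N)) ⟩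
    N ℕ.+ (N ℕ.+ (2 * N ℕ.+ 4 * N))
      ≡⟨ regroup N ⟩
    8 * N ∎
    where
    open ℕ.≤-Reasoning
    N = k ^ 2 * n
    regroup : ∀ N → N ℕ.+ (N ℕ.+ (2 * N ℕ.+ 4 * N)) ≡ 8 * N
    regroup = solve-∀
    square : ∀ k n → k * (n * k) ≡ k * (k * 1) * n
    square = solve-∀
    double : ∀ k n → k * (n * 2) ≡ 2 * (n * k)
    double = solve-∀
    quadruple : ∀ k n → k * (n ℕ.+ n) * k * 2 ≡ 4 * (k * (k * 1) * n)
    quadruple = solve-∀
    n*k≤N : n * k ≤ N
    n*k≤N = ℕ.≤-trans (ℕ.m≤n*m (n * k) k) (ℕ.≤-reflexive (square k n))
    n≤N : n ≤ N
    n≤N = ℕ.≤-trans (ℕ.m≤m*n n k) n*k≤N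
    k*[n*2]≤2*N : k * (n * 2) ≤ 2 * N
    k*[n*2]≤2*N = ℕ.≤-trans (ℕ.≤-reflexive (double k n)) (ℕ.*-monoʳ-≤ 2 n*k≤N)
    k*[1+n]*k*2≤4*N : k * suc n * k * 2 ≤ 4 * N
    k*[1+n]*k*2≤4*N = ℕ.≤-trans
      (ℕ.*-monoˡ-≤ 2 (ℕ.*-monoˡ-≤ k (ℕ.*-monoʳ-≤ k (ℕ.+-monoˡ-≤ n 1≤n))))
      (ℕ.≤-reflexive (quadruple k n))

  maximize-correct : ∀ k n → 2 ≤ k → 1 ≤ n → (f : SetFunction n) → XOS k f →
                     IsMaximizer (fromℕ (k ∸ 1)) f (output (maximize n) f) ×
                     oracleCalls (maximize n) f ≤ 8 * (k ^ 2 * n)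
  maximize-correct k@(suc (suc m)) n 2≤k@(ℕ.s≤s (ℕ.s≤s _)) 1≤n f (fs , additive , maximum)
    with X , X-max ← maximum-exists f
       | ensures Z f≤ out calls ← maximize-ensures f fs additive maximum 2≤k
    = subst (IsMaximizer (fromℕ (suc m)) f) (sym (out return))
        (f X , ((X , refl) , X-max) , ≤·⇒⁻¹*≤ m (f≤ X))
    , ℕ.≤-trans (calls return)
        (ℕ.≤-trans (ℕ.≤-reflexive (ℕ.+-identityʳ _)) (calls-bound k n 2≤k 1≤n))

  maximize-exact : ∀ n → 1 ≤ n → (f : SetFunction n) → XOS 2 f →
                   IsExactMaximizer f (output (maximize n) f) ×
                   oracleCalls (maximize n) f ≤ 32 * n
  maximize-exact n 1≤n f xos
    with (m , (_ , f≤m) , m≤fZ) , calls ← maximize-correct 2 n ℕ.≤-refl 1≤n f xos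
    = ((_ , refl) , λ Y → ≤-trans (f≤m Y) (subst (_≤ᴿ _) (fromℕ-1⁻¹* m) m≤fZ))
    -- Since `2 ^ 2` evaluates to 4, the constant is 8 times 4.
    , ℕ.≤-trans calls (ℕ.≤-reflexive (sym (ℕ.*-assoc 8 4 n)))

theorem4 : ∀ {c ℓ} (R : OrderedField c ℓ) →
    let open SetFunctions R
        open OrderedField R using (fromℕ)
    in
    ∃ λ (A : ∀ n → Algorithm n) →
      (∃[ C ] (∀ k n → 2 ≤ k → 1 ≤ n → (f : SetFunction n) → XOS k f →
         IsMaximizer (fromℕ (k ∸ 1)) f (output (A n) f) ×
         oracleCalls (A n) f ≤ C * (k ^ 2 * n)))
      ×
      (∃[ D ] (∀ n → 1 ≤ n → (f : SetFunction n) → XOS 2 f →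
         IsExactMaximizer f (output (A n) f) ×
         oracleCalls (A n) f ≤ D * n))
theorem4 R = maximize , (8 , maximize-correct) , (32 , maximize-exact)
  where open XOSMaximization R
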